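{- Let $H$ be a hypergraph. Then $$T_{\mathrm{HG}}(H;x,y)=(x-1)^{ -\kappa(H)}(y-1)^{ -v(H)}\,Z_{\mathrm{RC}}\big(H;(x-1)(y-1),\,y-1\big)$$ (as an identity of rational functions in $x,y$), and $$Z_{\mathrm{RC}}(H;q,v)=q^{\kappa(H)}\,v^{\,v(H)-\kappa(H)}\,T_{\mathrm{HG}}\!\left(H;1+\frac{q}{v},\,1+v\right)$$ for $v\neq0$. (Here $v$ as a variable is distinct from the vertex count $v(H)$.)
   Context: A hypergraph is a pair $H=(V,E)$ where $V$ is a finite set and $E$ is a finite multiset (parallel hyperedges are allowed and treated as distinct elements of $E$) of multisets of elements of $V$, called hyperedges. For $e\in E$, $d(e)$ is the size of $e$ counted with multiplicity; it is always assumed that $d(e)>1$. Write $v(H)=|V|$. $\kappa(H)$ is the number of connected components of the bipartite incidence graph with vertex classes $V$ and $E$, in which $u\in V$ and $e\in E$ are joined by as many edges as the multiplicity of $u$ in $e$. For $A\subseteq E$ let $\kappa(A)=\kappa((V,A))$, $d(A)=\sum_{e\in A}d(e)$, and $|A|$ is the number of hyperedges in $A$. Hypergraph Tutte polynomial: $T_{\mathrm{HG}}(H;x,y)=\sum_{A\subseteq E}(x-1)^{\kappa(A)-\kappa(H)}(y-1)^{d(A)-|A|-v(H)+\kappa(A)}$. Degree-dependent hypergraph random cluster partition function: $Z_{\mathrm{RC}}(H;q,v)=\sum_{A\subseteq E}q^{\kappa(A)}\prod_{e\in A}v^{d(e)-1}$. -}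

module Defs where

open import Algebra.Bundles using (CommutativeRing)
import Algebra.Definitions as AlgebraDefinitions
import Algebra.Properties.Semiring.Exp as SemiringExp
open import Data.Empty using (⊥)
open import Data.Fin.Base using (Fin; zero; suc)
import Data.Fin.Properties as Fin
open import Data.Integer.Base using (ℤ; +_; -[1+_])
open import Data.List.Base
  using (List; []; _∷_; _++_; map; foldr; length; lookup; filter;
         deduplicate; allFin; cartesianProduct)
open import Data.List.Membership.Propositional using (_∈_)
open import Data.List.Membership.Propositional.Properties
  using (∈-filter⁺; ∈-filter⁻; ∈-map⁺; ∈-++⁺ˡ; ∈-++⁺ʳ; ∈-allFin;
         ∈-cartesianProduct⁺)
open import Data.List.Relation.Unary.Any using (here; there)
open import Data.Nat.Base as ℕ using (ℕ; zero; suc; _∸_)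
open import Data.Nat.ListAction using (sum)
open import Data.Product.Base using (_×_; _,_; proj₁; proj₂)
open import Data.Sum.Base using (_⊎_; inj₁; inj₂)
open import Data.Sum.Properties using (≡-dec)
import Data.Vec.Base as Vec
open Vec using (Vec)
open import Relation.Binary.Construct.Closure.Equivalence as EqC
  using (EqClosure)
open import Relation.Binary.Construct.Closure.ReflexiveTransitive
  using (ε; _◅_; _◅◅_)
open import Relation.Binary.Construct.Closure.Symmetric using (fwd; bwd)
open import Relation.Binary.Core using (Rel)
open import Relation.Binary.Definitions using (Decidable; DecidableEquality)
open import Relation.Binary.PropositionalEquality.Core using (refl)
open import Relation.Nullary.Decidable.Core
  using (Dec; yes; no; map′; _×-dec_; _⊎-dec_)

------------------------------------------------------------------------
-- Hypergraphs

-- A multiset of elements of V = Fin n is its vector of multiplicities.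

record Hyperedge (n : ℕ) : Set where
  field
    multiplicity : Vec ℕ n

  d : ℕ
  d = Vec.sum multiplicity

  field
    d>1 : 1 ℕ.< d

open Hyperedge public

-- The vertex set is Fin #V.  The multiset of hyperedges is a list; its
-- positions are the hyperedges, so parallel hyperedges stay distinct.

record Hypergraph : Set where
  constructor hypergraph
  field
    #V : ℕ
    E  : List (Hyperedge #V)

open Hypergraph public

-- One sublist for each subset of positions, hence 2 ^ length xs entries
-- even when xs has repetitions.

subfamilies : ∀ {a} {A : Set a} → List A → List (List A)
subfamilies []       = [] ∷ []
subfamilies (x ∷ xs) = subfamilies xs ++ map (x ∷_) (subfamilies xs)

------------------------------------------------------------------------
-- Connectivity in a finite graph is decidable

module _ {α} {A : Set α} (_≟_ : DecidableEquality A) where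

  private
    Edge : List (A × A) → Rel A α
    Edge ps x y = (x , y) ∈ ps

    -- Adding the pair (a , b) joins the classes of a and of b.
    Joined : ∀ (a b : A) → List (A × A) → Rel A α
    Joined a b ps x y =
      x ~ y ⊎ ((x ~ a × b ~ y) ⊎ (x ~ b × a ~ y))
      where _~_ = EqClosure (Edge ps)

    weaken : ∀ {p ps x y} →
             EqClosure (Edge ps) x y → EqClosure (Edge (p ∷ ps)) x y
    weaken = EqC.map there

    sound : ∀ {a b ps x y} → Joined a b ps x y →
            EqClosure (Edge ((a , b) ∷ ps)) x y
    sound (inj₁ p)              = weaken p
    sound (inj₂ (inj₁ (p , q))) = weaken p ◅◅ fwd (here refl) ◅ weaken q
    sound (inj₂ (inj₂ (p , q))) = weaken p ◅◅ bwd (here refl) ◅ weaken q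

    prepend : ∀ {a b ps x z y} → EqClosure (Edge ps) x z →
              Joined a b ps z y → Joined a b ps x y
    prepend s (inj₁ p)              = inj₁ (s ◅◅ p)
    prepend s (inj₂ (inj₁ (p , q))) = inj₂ (inj₁ (s ◅◅ p , q))
    prepend s (inj₂ (inj₂ (p , q))) = inj₂ (inj₂ (s ◅◅ p , q))

    complete : ∀ {a b ps x y} → EqClosure (Edge ((a , b) ∷ ps)) x y →
               Joined a b ps x y
    complete ε = inj₁ ε
    complete (fwd (there i) ◅ r) = prepend (fwd i ◅ ε) (complete r)
    complete (bwd (there i) ◅ r) = prepend (bwd i ◅ ε) (complete r)
    complete (fwd (here refl) ◅ r) with complete r
    ... | inj₁ p              = inj₂ (inj₁ (ε , p))
    ... | inj₂ (inj₁ (_ , q)) = inj₂ (inj₁ (ε , q))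
    ... | inj₂ (inj₂ (_ , q)) = inj₁ q
    complete (bwd (here refl) ◅ r) with complete r
    ... | inj₁ p              = inj₂ (inj₂ (ε , p))
    ... | inj₂ (inj₁ (_ , q)) = inj₁ q
    ... | inj₂ (inj₂ (_ , q)) = inj₂ (inj₂ (ε , q))

    edgeClosure? : ∀ ps → Decidable (EqClosure (Edge ps))
    edgeClosure? [] x y = map′ (λ { refl → ε }) empty (x ≟ y)
      where
      empty : EqClosure (Edge []) x y → _
      empty ε              = refl
      empty (fwd () ◅ _)
      empty (bwd () ◅ _)
    edgeClosure? ((a , b) ∷ ps) x y = map′ sound complete
      (x ~? y ⊎-dec ((x ~? a ×-dec b ~? y) ⊎-dec (x ~? b ×-dec a ~? y)))
      where _~?_ = edgeClosure? ps

  eqClosure? : ∀ {ℓ} {_↝_ : Rel A ℓ} → Decidable _↝_ →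
               (xs : List A) → (∀ x → x ∈ xs) → Decidable (EqClosure _↝_)
  eqClosure? {_↝_ = _↝_} _↝?_ xs all x y =
    map′ (EqC.map toR) (EqC.map fromR) (edgeClosure? pairs x y)
    where
    R? : ∀ p → Dec (proj₁ p ↝ proj₂ p)
    R? p = proj₁ p ↝? proj₂ p

    pairs : List (A × A)
    pairs = filter R? (cartesianProduct xs xs)

    toR : ∀ {x y} → Edge pairs x y → x ↝ y
    toR i = proj₂ (∈-filter⁻ R? {xs = cartesianProduct xs xs} i)

    fromR : ∀ {x y} → x ↝ y → Edge pairs x y
    fromR {x} {y} r = ∈-filter⁺ R? (∈-cartesianProduct⁺ (all x) (all y)) r

------------------------------------------------------------------------
-- The incidence graph and its number of connected components

module _ (H : Hypergraph) where

  Node : Set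
  Node = Fin (#V H) ⊎ Fin (length (E H))

  nodes : List Node
  nodes = map inj₁ (allFin (#V H)) ++ map inj₂ (allFin (length (E H)))

  -- The type of edges between two nodes: u and e are joined by as many
  -- edges as the multiplicity of u in e.

  Incidence : Rel Node _
  Incidence (inj₁ u) (inj₂ e) =
    Fin (Vec.lookup (multiplicity (lookup (E H) e)) u)
  Incidence _        _        = ⊥

  Connected : Rel Node _
  Connected = EqClosure Incidence

  _≟ᴺ_ : DecidableEquality Node
  _≟ᴺ_ = ≡-dec Fin._≟_ Fin._≟_

  ∈-nodes : ∀ x → x ∈ nodes
  ∈-nodes (inj₁ u) = ∈-++⁺ˡ (∈-map⁺ inj₁ (∈-allFin u))
  ∈-nodes (inj₂ e) = ∈-++⁺ʳ _ (∈-map⁺ inj₂ (∈-allFin e))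

  incidence? : Decidable Incidence
  incidence? (inj₁ u) (inj₂ e)
    with Vec.lookup (multiplicity (lookup (E H) e)) u
  ... | zero  = no λ ()
  ... | suc _ = yes zero
  incidence? (inj₁ _) (inj₁ _) = no λ ()
  incidence? (inj₂ _) (inj₁ _) = no λ ()
  incidence? (inj₂ _) (inj₂ _) = no λ ()

  connected? : Decidable Connected
  connected? = eqClosure? _≟ᴺ_ incidence? nodes ∈-nodes

  -- One node is kept from each connected component.

  κ : ℕ
  κ = length (deduplicate connected? nodes)

------------------------------------------------------------------------
-- The Tutte polynomial and the random cluster partition function

dSum : ∀ {n} → List (Hyperedge n) → ℕ
dSum A = sum (map d A)

-- Both polynomials have integer coefficients; they are evaluated at
-- elements of an arbitrary commutative ring.

module HypergraphPolynomials {c ℓ} (R : CommutativeRing c ℓ) where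

  open CommutativeRing R
  open SemiringExp semiring using (_^_) public
  open AlgebraDefinitions _≈_ using (Invertible)

  IsUnit : Carrier → Set _
  IsUnit = Invertible 1# _*_

  infixr 8 _^ᶻ_

  -- Integer powers of a unit, given with its inverse.
  _^ᶻ_ : ∀ {a} → IsUnit a → ℤ → Carrier
  _^ᶻ_ {a} _         (+ n)    = a ^ n
  _^ᶻ_     (a⁻¹ , _) -[1+ n ] = a⁻¹ ^ suc n

  ∑ ∏ : List Carrier → Carrier
  ∑ = foldr _+_ 0#
  ∏ = foldr _*_ 1#

  -- Since κ(A) ≥ κ(H) and d(A) + κ(A) ≥ |A| + v(H) for every A ⊆ E, the
  -- subtractions in the exponents are never actually truncated.

  T-HG : Hypergraph → Carrier → Carrier → Carrier
  T-HG H x y = ∑ (map term (subfamilies (E H)))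
    where
    term : List (Hyperedge (#V H)) → Carrier
    term A = (x - 1#) ^ (κA ∸ κ H)
           * (y - 1#) ^ ((dSum A ℕ.+ κA) ∸ (length A ℕ.+ #V H))
      where κA = κ (hypergraph (#V H) A)

  Z-RC : Hypergraph → Carrier → Carrier → Carrier
  Z-RC H q v = ∑ (map term (subfamilies (E H)))
    where
    term : List (Hyperedge (#V H)) → Carrier
    term A = q ^ κ (hypergraph (#V H) A)
           * ∏ (map (λ e → v ^ (d e ∸ 1)) A)

{-# OPTIONS --safe #-}

-- In the second identity the A-summands agree one by one, by comparing exponents
-- with Σ_{e∈A} (d(e) - 1) = d(A) - |A|.  The subtractions in the exponents of
-- T-HG are truncated, so this needs κ(H) ≤ κ(A) and v(H) ≤ d(A) - |A| + κ(A).
-- The former holds because every hyperedge contains a vertex, the latter by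
-- induction on A, because adding e merges at most d(e) components.  The first
-- identity follows from the second at q = (x - 1)(y - 1), v = y - 1.

module Submission where

open import Defs
open import Algebra.Bundles using (CommutativeRing)
open import Data.Integer.Base as ℤ using (+_)
open import Data.Product.Base using (_×_; proj₁)
import Algebra.Properties.AbelianGroup as AbelianGroupProperties
import Algebra.Properties.CommutativeSemiring.Exp as CommutativeSemiringExp
import Algebra.Solver.CommutativeMonoid as CommutativeMonoidSolver
open import Data.Fin.Base using (Fin; zero; suc)
import Data.Integer.Properties as ℤ
open import Data.List.Base
  using (List; []; _∷_; _++_; map; length; lookup; filter; deduplicate;
         replicate; allFin)
open import Data.List.Membership.Propositional using (_∈_; find; lose)
open import Data.List.Membership.Propositional.Properties
  using (∈-filter⁺; ∈-map⁺; ∈-++⁺ʳ; ∈-lookup)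
open import Data.List.Properties
  using (length-++; length-map; length-replicate; length-removeAt′;
         length-tabulate; filter-notAll)
open import Data.List.Relation.Binary.Subset.Propositional using (_⊆_)
import Data.List.Relation.Binary.Subset.Propositional.Properties as ⊆
open import Data.List.Relation.Unary.All as All using (All; []; _∷_)
import Data.List.Relation.Unary.All.Properties as All
open import Data.List.Relation.Unary.AllPairs as AllPairs
  using (AllPairs; []; _∷_)
open import Data.List.Relation.Unary.Any as Any using (Any; here; there)
import Data.List.Relation.Unary.Any.Properties as Any
open import Data.List.Relation.Unary.Unique.DecSetoid.Properties
  using (deduplicate-!)
open import Data.List.Relation.Unary.Unique.Propositional.Properties
  using (allFin⁺)
open import Data.Nat.Base as ℕ
  using (ℕ; zero; suc; _∸_; _≤_; _<_; z≤n; s≤s; z<s)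
open import Data.Nat.ListAction using (sum)
import Data.Nat.Properties as ℕ
open import Data.Nat.Tactic.RingSolver using (solve-∀)
open import Data.Product.Base using (∃-syntax; _,_)
open import Data.Sum.Base as Sum using (_⊎_; inj₁; inj₂)
open import Data.Vec.Base as Vec using (Vec; []; _∷_)
open import Function.Base using (_∘_)
open import Level using (Level)
open import Relation.Binary.Bundles using (DecSetoid)
import Relation.Binary.Construct.Closure.Equivalence as EqC
open import Relation.Binary.Construct.Closure.ReflexiveTransitive
  using (ε; _◅_; _◅◅_)
open import Relation.Binary.Construct.Closure.Symmetric using (fwd; bwd)
open import Relation.Binary.Core using (REL)
open import Relation.Binary.PropositionalEquality
  using (_≡_; refl; sym; trans; cong; cong₂; subst; module ≡-Reasoning)
open import Relation.Nullary using (¬_; yes; no; contradiction)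
open import Relation.Nullary.Decidable using (¬?)
open import Relation.Unary using (Pred)

private
  variable
    α β p q r : Level
    A : Set α
    B : Set β

-- Counting by systems of representatives

any-─ : {P : Pred A p} {Q : Pred A q} {xs : List A} (i : Any P xs) →
        Any Q xs → Any Q (xs Any.─ i) ⊎ Q (Any.lookup i)
any-─ (here _)  (here q)  = inj₂ q
any-─ (here _)  (there j) = inj₁ j
any-─ (there i) (here q)  = inj₁ (here q)
any-─ (there i) (there j) = Sum.map₁ there (any-─ i j)

-- Delete from `ys` the element matched with the head of `xs`. No later element is related to it, so
-- by `any-─` the later matches survive and the induction goes on.
pigeonhole : {R : REL A B r} {xs : List A} {ys : List B} →
             AllPairs (λ x x′ → ∀ y → R x y → ¬ R x′ y) xs →
             All (λ x → Any (R x) ys) xs →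
             length xs ≤ length ys
pigeonhole [] [] = z≤n
pigeonhole {R = R} {ys = ys} (x# ∷ xs#) (i ∷ is) =
  subst (_ ≤_) (sym (length-removeAt′ ys (Any.index i)))
    (s≤s (pigeonhole xs# (All.zipWith avoid (x# , is))))
  where
  avoid : ∀ {x′} → (∀ y → R _ y → ¬ R x′ y) × Any (R x′) ys →
          Any (R x′) (ys Any.─ i)
  avoid (# , j) with any-─ i j
  ... | inj₁ k = k
  ... | inj₂ r = contradiction r (# _ (Any.lookup-result i))

module _ (H : Hypergraph) where

  connectedDecSetoid : DecSetoid _ _
  connectedDecSetoid = record
    { isDecEquivalence = record
      { isEquivalence = EqC.isEquivalence (Incidence H)
      ; _≟_           = connected? H
      }
    }

  representatives : List (Node H)
  representatives = deduplicate (connected? H) (nodes H)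

  represented : ∀ x → Any (Connected H x) representatives
  represented x =
    Any.deduplicate⁺ (connected? H)
      (λ z~y x~y → x~y ◅◅ EqC.symmetric _ z~y)
      (Any.map (λ { refl → ε }) (∈-nodes H x))

  -- Representatives lie in distinct components, so functionality forbids two of them to share an
  -- element of `zs`.
  κ≤length : {R : REL (Node H) B r} →
             (∀ {x y z} → R x z → R y z → Connected H x y) →
             (zs : List B) → (∀ x → Any (R x) zs) → κ H ≤ length zs
  κ≤length functional zs cover = pigeonhole
    (AllPairs.map (λ x≁y _ xRz yRz → x≁y (functional xRz yRz))
      (deduplicate-! connectedDecSetoid (nodes H)))
    (All.universal cover representatives)

-- Monotonicity of κ

incident-vertex : ∀ {n} (ms : Vec ℕ n) → 0 < Vec.sum ms →
                  ∃[ u ] Fin (Vec.lookup ms u)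
incident-vertex (zero  ∷ ms) 0<s with incident-vertex ms 0<s
... | u , i = suc u , i
incident-vertex (suc _ ∷ ms) _ = zero , zero

-- A hyperedge has positive size, hence an incident vertex. Vertices are what the incidence graphs
-- of different subfamilies have in common.
connected-vertex : ∀ H (x : Node H) → ∃[ u ] Connected H x (inj₁ u)
connected-vertex H (inj₁ u) = u , ε
connected-vertex H (inj₂ e)
  with incident-vertex (multiplicity (lookup (E H) e))
         (ℕ.<-trans z<s (d>1 (lookup (E H) e)))
... | u , i = u , bwd i ◅ ε

-- Representatives for `A`, carried over to the incidence graph of `B`, meet every component there,
-- because each component contains a vertex.
κ-antitone : ∀ {n} {A B : List (Hyperedge n)} → A ⊆ B →
             κ (hypergraph n B) ≤ κ (hypergraph n A)
κ-antitone {n} {A} {B} A⊆B =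
  κ≤length HB {R = λ x z → Connected HB x (ι z)}
    (λ x~z y~z → x~z ◅◅ EqC.symmetric _ y~z)
    (representatives HA) cover
  where
  HA HB : Hypergraph
  HA = hypergraph n A
  HB = hypergraph n B

  position : ∀ e → lookup A e ∈ B
  position e = A⊆B (∈-lookup e)

  -- May identify parallel hyperedges of `A`, since `A ⊆ B` only compares members; it still carries
  -- paths to paths.
  ι : Node HA → Node HB
  ι = Sum.map₂ (Any.index ∘ position)

  ι-incidence : ∀ {x y} → Incidence HA x y → Incidence HB (ι x) (ι y)
  ι-incidence {inj₁ u} {inj₂ e} =
    subst (λ f → Fin (Vec.lookup (multiplicity f) u))
      (Any.lookup-index (position e))

  cover : ∀ x → Any (λ z → Connected HB x (ι z)) (representatives HA)
  cover x with connected-vertex HB x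
  ... | u , x~u = Any.map
    (λ u~z → x~u ◅◅ EqC.gmap ι (λ {y} {z} → ι-incidence {y} {z}) u~z)
    (represented HA (inj₁ u))

-- The effect on κ of adding a hyperedge

occurrences : ∀ {n} → Vec ℕ n → List (Fin n)
occurrences []       = []
occurrences (m ∷ ms) = replicate m zero ++ map suc (occurrences ms)

length-occurrences : ∀ {n} (ms : Vec ℕ n) →
                     length (occurrences ms) ≡ Vec.sum ms
length-occurrences []       = refl
length-occurrences (m ∷ ms) = trans (length-++ (replicate m zero))
  (cong₂ ℕ._+_ (length-replicate m)
    (trans (length-map suc (occurrences ms)) (length-occurrences ms)))

∈-occurrences : ∀ {n} (ms : Vec ℕ n) u → Fin (Vec.lookup ms u) →
                u ∈ occurrences ms
∈-occurrences (suc m ∷ ms) zero    _ = here refl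
∈-occurrences (m ∷ ms)     (suc u) i =
  ∈-++⁺ʳ (replicate m zero) (∈-map⁺ suc (∈-occurrences ms u i))

-- The component of e splits, on removing e, into classes met by vertices of e:
-- replacing its representative by these vertices still represents everything.
κ-∷ : ∀ {n} (e : Hyperedge n) (A : List (Hyperedge n)) →
      suc (κ (hypergraph n A)) ≤ d e ℕ.+ κ (hypergraph n (e ∷ A))
κ-∷ {n} e A = begin
  suc (κ HA)
    ≤⟨ s≤s (κ≤length HA functional (ends ++ others) cover) ⟩
  suc (length (ends ++ others))
    ≡⟨ cong suc (length-++ ends) ⟩
  suc (length ends ℕ.+ length others)
    ≡⟨ ℕ.+-suc (length ends) (length others) ⟨
  length ends ℕ.+ suc (length others)
    -- The representative of the component of `ê` is filtered out, so `others` is strictly shorter.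
    -- This absorbs the `suc`.
    ≤⟨ ℕ.+-monoʳ-≤ (length ends)
         (filter-notAll away? (representatives He)
           (Any.map (λ e~z e≁z → e≁z e~z) (represented He ê))) ⟩
  length ends ℕ.+ κ He
    ≡⟨ cong (ℕ._+ κ He) (trans (length-map inj₁ (occurrences (multiplicity e)))
                             (length-occurrences (multiplicity e))) ⟩
  d e ℕ.+ κ He ∎
  where
  open ℕ.≤-Reasoning

  HA He : Hypergraph
  HA = hypergraph n A
  He = hypergraph n (e ∷ A)

  ê : Node He
  ê = inj₂ zero

  away? = λ z → ¬? (connected? He ê z)

  ends others : List (Node He)
  ends   = map inj₁ (occurrences (multiplicity e))
  others = filter away? (representatives He)

  ι : Node HA → Node He
  ι = Sum.map₂ suc

  ι-injective : ∀ x y → ι x ≡ ι y → x ≡ y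
  ι-injective (inj₁ _) (inj₁ _) refl = refl
  ι-injective (inj₂ _) (inj₂ _) refl = refl

  -- Connectivity in the smaller graph, with the endpoint written as a node of the larger one.
  -- Nothing is related to `ê`, which is outside the image of `ι`.
  _⇝_ : REL (Node HA) (Node He) _
  x ⇝ z = ∃[ w ] ι w ≡ z × Connected HA x w

  functional : ∀ {x y z} → x ⇝ z → y ⇝ z → Connected HA x y
  functional (w , refl , x~w) (w′ , eq , y~w′) with ι-injective w′ w eq
  ... | refl = x~w ◅◅ EqC.symmetric _ y~w′

  prepend : ∀ {x y z} → Connected HA x y →
            y ⇝ z ⊎ Any (y ⇝_) ends → x ⇝ z ⊎ Any (x ⇝_) ends
  prepend x~y = Sum.map extend (Any.map extend)
    where
    extend : ∀ {z} → _ ⇝ z → _ ⇝ z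
    extend (w , eq , y~w) = w , eq , x~y ◅◅ y~w

  -- Walk along the path. If it reaches `ê`, the vertex just before is one of `ends` and the walk
  -- stops there; otherwise the whole path lifts to the graph without `e`.
  follow : ∀ x {z} → Connected He (ι x) z → x ⇝ z ⊎ Any (x ⇝_) ends
  follow x ε = inj₁ (x , refl , ε)
  follow (inj₁ u) (_◅_ {j = inj₂ zero} (fwd i) _) =
    inj₂ (lose (∈-map⁺ inj₁ (∈-occurrences (multiplicity e) u i))
               (inj₁ u , refl , ε))
  follow (inj₁ u) (_◅_ {j = inj₂ (suc f)} (fwd i) r) =
    prepend (fwd i ◅ ε) (follow (inj₂ f) r)
  follow (inj₁ u) (_◅_ {j = inj₁ _} (fwd ()) _)
  follow (inj₁ u) (_◅_ {j = inj₁ _} (bwd ()) _)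
  follow (inj₁ u) (_◅_ {j = inj₂ _} (bwd ()) _)
  follow (inj₂ f) (_◅_ {j = inj₁ u} (bwd i) r) =
    prepend (bwd i ◅ ε) (follow (inj₁ u) r)
  follow (inj₂ f) (_◅_ {j = inj₁ _} (fwd ()) _)
  follow (inj₂ f) (_◅_ {j = inj₂ _} (bwd ()) _)
  follow (inj₂ f) (_◅_ {j = inj₂ _} (fwd ()) _)

  ¬⇝ê : ∀ {x} → ¬ (x ⇝ ê)
  ¬⇝ê (inj₁ _ , () , _)
  ¬⇝ê (inj₂ _ , () , _)

  cover : ∀ x → Any (x ⇝_) (ends ++ others)
  cover x with find (represented He (ι x))
  ... | z , z∈ , x~z with connected? He ê z
  ... | no  e≁z = Sum.[ Any.++⁺ʳ ends ∘ lose (∈-filter⁺ away? z∈ e≁z)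
                      , Any.++⁺ˡ ]′ (follow x x~z)
  -- Here `z` was filtered out. The path is continued to `ê`, so it passes through one of `ends`.
  ... | yes e~z = Sum.[ (λ x⇝ê → contradiction x⇝ê ¬⇝ê) , Any.++⁺ˡ ]′
                    (follow x (x~z ◅◅ EqC.symmetric _ e~z))

-- Exponents of the summands

n≤κ[] : ∀ n → n ≤ κ (hypergraph n [])
n≤κ[] n = subst (_≤ κ H) (length-tabulate {n = n} (λ u → u))
  (pigeonhole {R = λ u → Connected H (inj₁ u)}
    (AllPairs.map
      (λ u≢v _ u~z v~z → u≢v (isolated (u~z ◅◅ EqC.symmetric _ v~z)))
      (allFin⁺ n))
    (All.universal (λ u → represented H (inj₁ u)) (allFin n)))
  where
  H : Hypergraph
  H = hypergraph n []

  isolated : ∀ {u v} → Connected H (inj₁ u) (inj₁ v) → u ≡ v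
  isolated ε = refl
  -- A neighbour `inj₂ _` would be a hyperedge of the empty family, so only these impossible steps
  -- remain.
  isolated (_◅_ {j = inj₁ _} (fwd ()) _)
  isolated (_◅_ {j = inj₁ _} (bwd ()) _)

-- The exponent of `v` in the summand of `A` in `Z-RC`.
excess : ∀ {n} → List (Hyperedge n) → ℕ
excess A = sum (map (λ e → d e ∸ 1) A)

excess+length : ∀ {n} (A : List (Hyperedge n)) →
                excess A ℕ.+ length A ≡ dSum A
excess+length []      = refl
excess+length (e ∷ A) with d e | d>1 e | excess+length A
-- `d>1` excludes `d e = 0`, so the subtraction of 1 is never truncated.
... | suc m | _ | eq = trans (rearrange m (excess A) (length A))
                             (cong (λ s → suc m ℕ.+ s) eq)
  where
  rearrange : ∀ m s l → m ℕ.+ s ℕ.+ suc l ≡ suc m ℕ.+ (s ℕ.+ l)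
  rearrange = solve-∀

-- Adding `e` raises the excess by d(e) - 1 and, by `κ-∷`, lowers κ by at most as much.
n≤excess+κ : ∀ {n} (A : List (Hyperedge n)) →
             n ≤ excess A ℕ.+ κ (hypergraph n A)
n≤excess+κ {n} []      = n≤κ[] n
n≤excess+κ {n} (e ∷ A) = begin
  n                                      ≤⟨ n≤excess+κ A ⟩
  excess A ℕ.+ κ (hypergraph n A)        ≤⟨ ℕ.+-monoʳ-≤ (excess A) step ⟩
  excess A ℕ.+ (d e ∸ 1 ℕ.+ κe)          ≡⟨ rearrange (excess A) (d e ∸ 1) κe ⟩
  d e ∸ 1 ℕ.+ excess A ℕ.+ κe            ∎
  where
  open ℕ.≤-Reasoning

  κe : ℕ
  κe = κ (hypergraph n (e ∷ A))

  step : κ (hypergraph n A) ≤ d e ∸ 1 ℕ.+ κe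
  step with d e | d>1 e | κ-∷ e A
  ... | suc _ | _ | s≤s κ≤ = κ≤

  rearrange : ∀ s m k → s ℕ.+ (m ℕ.+ k) ≡ m ℕ.+ s ℕ.+ k
  rearrange = solve-∀

-- The y-exponent in T-HG, with the truncated subtraction undone.
nullity+n : ∀ {n} (A : List (Hyperedge n)) → let κA = κ (hypergraph n A) in
            ((dSum A ℕ.+ κA) ∸ (length A ℕ.+ n)) ℕ.+ n ≡ excess A ℕ.+ κA
nullity+n {n} A = begin
  (dSum A ℕ.+ κA) ∸ (length A ℕ.+ n) ℕ.+ n
    ≡⟨ cong (λ s → (s ℕ.+ κA) ∸ (length A ℕ.+ n) ℕ.+ n) (excess+length A) ⟨
  (excess A ℕ.+ length A ℕ.+ κA) ∸ (length A ℕ.+ n) ℕ.+ n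
    ≡⟨ cong (λ s → s ∸ (length A ℕ.+ n) ℕ.+ n)
         (rearrange (excess A) (length A) κA) ⟩
  (length A ℕ.+ (excess A ℕ.+ κA)) ∸ (length A ℕ.+ n) ℕ.+ n
    ≡⟨ cong (ℕ._+ n) (ℕ.[m+n]∸[m+o]≡n∸o (length A) (excess A ℕ.+ κA) n) ⟩
  (excess A ℕ.+ κA) ∸ n ℕ.+ n
    ≡⟨ ℕ.m∸n+n≡m (n≤excess+κ A) ⟩
  excess A ℕ.+ κA ∎
  where
  open ≡-Reasoning

  κA : ℕ
  κA = κ (hypergraph n A)

  rearrange : ∀ s l k → s ℕ.+ l ℕ.+ k ≡ l ℕ.+ (s ℕ.+ k)
  rearrange = solve-∀

-- Provides the inclusion under which `κ-antitone` gives κ(H) ≤ κ(A) for each summand.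
subfamilies-⊆ : (xs : List A) → All (_⊆ xs) (subfamilies xs)
subfamilies-⊆ []       = (λ i → i) ∷ []
subfamilies-⊆ (x ∷ xs) = All.++⁺
  (All.map (λ A⊆xs {_} i → there (A⊆xs i)) (subfamilies-⊆ xs))
  (All.map⁺ (All.map (⊆.∷⁺ʳ x) (subfamilies-⊆ xs)))

-- The identities between the two polynomials

module _ {c ℓ} (R : CommutativeRing c ℓ) where

  open CommutativeRing R
    renaming (refl to ≈-refl; sym to ≈-sym; trans to ≈-trans)
  open HypergraphPolynomials R
  open CommutativeSemiringExp commutativeSemiring
    using (^-congˡ; ^-congʳ; ^-homo-*; ^-distrib-*)
  open AbelianGroupProperties +-abelianGroup using (xyx⁻¹≈y; //-rightDividesˡ)
  open CommutativeMonoidSolver *-commutativeMonoid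
    using (solve; _⊕_; _⊜_)
  open import Relation.Binary.Reasoning.Setoid setoid

  -- Powers of units

  ^-inverse : ∀ {a b} → a * b ≈ 1# → ∀ n → a ^ n * b ^ n ≈ 1#
  ^-inverse {a} {b} ab≈1 n = begin
    a ^ n * b ^ n ≈⟨ ^-distrib-* a b n ⟨
    (a * b) ^ n   ≈⟨ ^-congˡ n ab≈1 ⟩
    1# ^ n        ≈⟨ 1^ n ⟩
    1#            ∎
    where
    1^ : ∀ n → 1# ^ n ≈ 1#
    1^ zero    = ≈-refl
    1^ (suc n) = ≈-trans (*-identityˡ _) (1^ n)

  ^ᶻ-neg : ∀ {a} (u : IsUnit a) n → u ^ᶻ (ℤ.- (+ n)) ≈ proj₁ u ^ n
  ^ᶻ-neg u zero    = ≈-refl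
  ^ᶻ-neg u (suc n) = ≈-refl

  -- Each common step of `m` and `n` cancels one factor `a` against its inverse, until one of the
  -- two exponents is zero and the power unfolds.
  ^ᶻ-⊖ : ∀ {a} (u : IsUnit a) m n → u ^ᶻ (m ℤ.⊖ n) ≈ a ^ m * proj₁ u ^ n
  ^ᶻ-⊖ u zero    zero    = ≈-sym (*-identityˡ _)
  ^ᶻ-⊖ u zero    (suc n) = ≈-sym (*-identityˡ _)
  ^ᶻ-⊖ u (suc m) zero    = ≈-sym (*-identityʳ _)
  ^ᶻ-⊖ {a} u@(w , _ , aw≈1) (suc m) (suc n) = begin
    u ^ᶻ (suc m ℤ.⊖ suc n)      ≡⟨ cong (u ^ᶻ_) (ℤ.[1+m]⊖[1+n]≡m⊖n m n) ⟩
    u ^ᶻ (m ℤ.⊖ n)              ≈⟨ ^ᶻ-⊖ u m n ⟩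
    a ^ m * w ^ n               ≈⟨ *-identityˡ _ ⟨
    1# * (a ^ m * w ^ n)        ≈⟨ *-congʳ aw≈1 ⟨
    a * w * (a ^ m * w ^ n)
      ≈⟨ solve 4 (λ a w s t → (a ⊕ w) ⊕ (s ⊕ t) ⊜ (a ⊕ s) ⊕ (w ⊕ t))
           ≈-refl a w (a ^ m) (w ^ n) ⟩
    a ^ suc m * w ^ suc n       ∎

  ^ᶻ-sub : ∀ {a} (u : IsUnit a) m n →
           u ^ᶻ ((+ m) ℤ.- (+ n)) ≈ a ^ m * proj₁ u ^ n
  ^ᶻ-sub u m n =
    ≈-trans (reflexive (cong (u ^ᶻ_) (ℤ.m-n≡m⊖n m n))) (^ᶻ-⊖ u m n)

  -- Sums, products and single summands

  ∑-cong : {f g : A → Carrier} {xs : List A} →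
           All (λ x → f x ≈ g x) xs → ∑ (map f xs) ≈ ∑ (map g xs)
  ∑-cong []         = ≈-refl
  ∑-cong (eq ∷ eqs) = +-cong eq (∑-cong eqs)

  *-distribˡ-∑ : (s : Carrier) (f : A → Carrier) (xs : List A) →
                 ∑ (map (λ x → s * f x) xs) ≈ s * ∑ (map f xs)
  *-distribˡ-∑ s f []       = ≈-sym (zeroʳ s)
  *-distribˡ-∑ s f (x ∷ xs) =
    ≈-trans (+-congˡ (*-distribˡ-∑ s f xs)) (≈-sym (distribˡ s _ _))

  ∏-powers : ∀ {n} v (A : List (Hyperedge n)) →
             ∏ (map (λ e → v ^ (d e ∸ 1)) A) ≈ v ^ excess A
  ∏-powers v []      = ≈-refl
  ∏-powers v (e ∷ A) =
    ≈-trans (*-congˡ (∏-powers v A)) (≈-sym (^-homo-* v (d e ∸ 1) (excess A)))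

  T-HG-cong : ∀ H {x x′ y y′} → x ≈ x′ → y ≈ y′ → T-HG H x y ≈ T-HG H x′ y′
  T-HG-cong H x≈x′ y≈y′ = ∑-cong (All.universal
    (λ A → *-cong (^-congˡ (κ (hypergraph (#V H) A) ∸ κ H) (+-congʳ x≈x′))
                  (^-congˡ ((dSum A ℕ.+ κ (hypergraph (#V H) A))
                              ∸ (length A ℕ.+ #V H))
                    (+-congʳ y≈y′)))
    (subfamilies (E H)))

  -- h and k stand for κ(H) and κ(A), D for the sum of d(e) - 1 over A, and
  -- m for the exponent of y - 1.
  random-cluster-term : ∀ q v w → v * w ≈ 1# → ∀ {h k n m D} → h ≤ k →
    m ℕ.+ n ≡ D ℕ.+ k →
    q ^ k * v ^ D ≈
      q ^ h * (v ^ n * w ^ h) * ((q * w) ^ (k ∸ h) * v ^ m)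
  random-cluster-term q v w vw≈1 {h} {k} {n} {m} {D} h≤k m+n≡D+k =
    ≈-sym (begin
    q ^ h * (v ^ n * w ^ h) * ((q * w) ^ j * v ^ m)
      ≈⟨ *-congˡ (*-congʳ (^-distrib-* q w j)) ⟩
    q ^ h * (v ^ n * w ^ h) * ((q ^ j * w ^ j) * v ^ m)
      ≈⟨ solve 6 (λ qh vn wh qj wj vm →
           (qh ⊕ (vn ⊕ wh)) ⊕ ((qj ⊕ wj) ⊕ vm) ⊜
           (qh ⊕ qj) ⊕ ((vm ⊕ vn) ⊕ (wh ⊕ wj)))
           ≈-refl (q ^ h) (v ^ n) (w ^ h) (q ^ j) (w ^ j) (v ^ m) ⟩
    (q ^ h * q ^ j) * ((v ^ m * v ^ n) * (w ^ h * w ^ j))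
      -- The exponents of `q` and of `w` add up to h + (k - h) = k, those of `v` to D + k by
      -- hypothesis.
      ≈⟨ *-cong (join q) (*-cong
           (≈-trans (≈-sym (^-homo-* v m n)) (^-congʳ v m+n≡D+k)) (join w)) ⟩
    q ^ k * (v ^ (D ℕ.+ k) * w ^ k)
      ≈⟨ *-congˡ (*-congʳ (^-homo-* v D k)) ⟩
    q ^ k * ((v ^ D * v ^ k) * w ^ k)
      ≈⟨ *-congˡ (*-assoc _ _ _) ⟩
    q ^ k * (v ^ D * (v ^ k * w ^ k))
      -- `v ^ k` cancels against `w ^ k`, leaving the power of `v` that occurs in `Z-RC`.
      ≈⟨ *-congˡ (*-congˡ (^-inverse vw≈1 k)) ⟩
    q ^ k * (v ^ D * 1#)
      ≈⟨ *-congˡ (*-identityʳ _) ⟩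
    q ^ k * v ^ D ∎)
    where
    j : ℕ
    j = k ∸ h

    join : ∀ a → a ^ h * a ^ j ≈ a ^ k
    join a = ≈-trans (≈-sym (^-homo-* a h j)) (^-congʳ a (ℕ.m+[n∸m]≡n h≤k))

  -- The prefactor is the same for all `A`, so it can be taken out of the sum once the summands are
  -- compared.
  Z-RC-T-HG : ∀ H q v (u : IsUnit v) →
    Z-RC H q v ≈
      q ^ κ H * (v ^ #V H * proj₁ u ^ κ H)
        * T-HG H (1# + q * proj₁ u) (1# + v)
  Z-RC-T-HG H q v (w , _ , vw≈1) = ≈-trans
    (∑-cong (All.map (λ {A} → term {A}) (subfamilies-⊆ (E H))))
    (*-distribˡ-∑ _ _ (subfamilies (E H)))
    where
    1+a-1 : ∀ a → a ≈ (1# + a) - 1#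
    1+a-1 a = ≈-sym (xyx⁻¹≈y 1# a)

    term : ∀ {A} → A ⊆ E H → _ ≈ _
    term {A} A⊆E = begin
      q ^ κA * ∏ (map (λ e → v ^ (d e ∸ 1)) A)
        ≈⟨ *-congˡ (∏-powers v A) ⟩
      q ^ κA * v ^ excess A
        ≈⟨ random-cluster-term q v w vw≈1 {n = #V H} {m} {excess A}
             (κ-antitone {A = A} A⊆E) (nullity+n A) ⟩
      q ^ κ H * (v ^ #V H * w ^ κ H)
        * ((q * w) ^ (κA ∸ κ H) * v ^ m)
        -- `T-HG` takes powers of its arguments minus `1#`, which are `q * w` and `v` here.
        ≈⟨ *-congˡ (*-cong (^-congˡ (κA ∸ κ H) (1+a-1 (q * w)))
             (^-congˡ m (1+a-1 v))) ⟩
      _ ∎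
      where
      κA m : ℕ
      κA = κ (hypergraph (#V H) A)
      m  = (dSum A ℕ.+ κA) ∸ (length A ℕ.+ #V H)

  T-HG-Z-RC : ∀ H x y (s : IsUnit (x - 1#)) (t : IsUnit (y - 1#)) →
    T-HG H x y ≈
      proj₁ s ^ κ H * proj₁ t ^ #V H
        * Z-RC H ((x - 1#) * (y - 1#)) (y - 1#)
  T-HG-Z-RC H x y (s⁻¹ , _ , s≈) t@(t⁻¹ , _ , t≈) = ≈-sym (begin
    s⁻¹ ^ h * t⁻¹ ^ n * Z-RC H (a * b) b
      ≈⟨ *-congˡ (Z-RC-T-HG H (a * b) b t) ⟩
    s⁻¹ ^ h * t⁻¹ ^ n * ((a * b) ^ h * (b ^ n * t⁻¹ ^ h)
      * T-HG H (1# + a * b * t⁻¹) (1# + b))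
      ≈⟨ *-congˡ (*-cong (*-congʳ (^-distrib-* a b h))
           (T-HG-cong H x-recovered (1+[z-1] y))) ⟩
    s⁻¹ ^ h * t⁻¹ ^ n * (a ^ h * b ^ h * (b ^ n * t⁻¹ ^ h) * T-HG H x y)
      -- Mutually inverse powers are brought together in three pairs, which then cancel one by one.
      ≈⟨ solve 7 (λ sh tn ah bh bn th T →
           (sh ⊕ tn) ⊕ (((ah ⊕ bh) ⊕ (bn ⊕ th)) ⊕ T) ⊜
           (ah ⊕ sh) ⊕ ((bn ⊕ tn) ⊕ ((bh ⊕ th) ⊕ T)))
           ≈-refl (s⁻¹ ^ h) (t⁻¹ ^ n) (a ^ h) (b ^ h) (b ^ n) (t⁻¹ ^ h)
           (T-HG H x y) ⟩
    a ^ h * s⁻¹ ^ h * (b ^ n * t⁻¹ ^ n * (b ^ h * t⁻¹ ^ h * T-HG H x y))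
      ≈⟨ cancel (^-inverse s≈ h) ⟩
    b ^ n * t⁻¹ ^ n * (b ^ h * t⁻¹ ^ h * T-HG H x y)
      ≈⟨ cancel (^-inverse t≈ n) ⟩
    b ^ h * t⁻¹ ^ h * T-HG H x y
      ≈⟨ cancel (^-inverse t≈ h) ⟩
    T-HG H x y ∎)
    where
    h n : ℕ
    h = κ H
    n = #V H

    a b : Carrier
    a = x - 1#
    b = y - 1#

    cancel : ∀ {r z} → r ≈ 1# → r * z ≈ z
    cancel r≈1 = ≈-trans (*-congʳ r≈1) (*-identityˡ _)

    1+[z-1] : ∀ z → 1# + (z - 1#) ≈ z
    1+[z-1] z = ≈-trans (+-comm 1# (z - 1#)) (//-rightDividesˡ 1# z)

    -- For q = (x - 1)(y - 1) and v = y - 1 the quotient q/v is x - 1.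
    x-recovered : 1# + a * b * t⁻¹ ≈ x
    x-recovered = begin
      1# + a * b * t⁻¹   ≈⟨ +-congˡ (*-assoc a b t⁻¹) ⟩
      1# + a * (b * t⁻¹) ≈⟨ +-congˡ (*-congˡ t≈) ⟩
      1# + a * 1#        ≈⟨ +-congˡ (*-identityʳ a) ⟩
      1# + a             ≈⟨ 1+[z-1] x ⟩
      x                   ∎

-- Stated at all points of every commutative ring where the denominators are units; this includes
-- the variables themselves in the field of rational functions.
proposition5p6 : ∀ {c ℓ} (R : CommutativeRing c ℓ) (H : Hypergraph) →
    let open CommutativeRing R
        open HypergraphPolynomials R
    in
    (∀ x y (x-1-unit : IsUnit (x - 1#)) (y-1-unit : IsUnit (y - 1#)) →
       T-HG H x y ≈
         x-1-unit ^ᶻ (ℤ.- (+ κ H)) * y-1-unit ^ᶻ (ℤ.- (+ #V H))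
           * Z-RC H ((x - 1#) * (y - 1#)) (y - 1#))
    ×
    (∀ q v (v-unit : IsUnit v) →
       Z-RC H q v ≈
         q ^ κ H * v-unit ^ᶻ ((+ #V H) ℤ.- (+ κ H))
           * T-HG H (1# + q * proj₁ v-unit) (1# + v))
proposition5p6 R H =
    (λ x y s t → ≈-trans (T-HG-Z-RC R H x y s t)
       (*-congʳ (≈-sym (*-cong (^ᶻ-neg R s (κ H)) (^ᶻ-neg R t (#V H))))))
  , (λ q v u → ≈-trans (Z-RC-T-HG R H q v u)
       (*-congʳ (*-congˡ (≈-sym (^ᶻ-sub R u (#V H) (κ H))))))
  where
  open CommutativeRing R using (*-cong; *-congˡ; *-congʳ)
    renaming (sym to ≈-sym; trans to ≈-trans)
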